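{- Let $n\ge 3$ and let $G$ be the 1-subdivision of the complete graph $K_n$, i.e. the graph obtained from $K_n$ by adding one new vertex in the middle of each edge. The ordinary cop number of $G$ (robber of speed $1$) is $2$, but if the robber can move at speed $2$, then the cop number of $G$ is $\lceil n/2\rceil=\Theta(\sqrt{v(G)})$, where $v(G)$ denotes the number of vertices of $G$.
   Context: Cops and Robbers with a robber of speed $R$ on a graph $G$: a perfect information game between a set of cops and one robber. First the cops are placed on vertices of their choice (several cops may share a vertex); then the robber, knowing the cops' placement, chooses a vertex. Then the cops and the robber move in alternate rounds, the cops moving first. In a cops' move each cop stays put or moves along one edge. In the robber's move he may traverse any walk of at most $R$ edges starting at his current position (possibly staying put), but he is not allowed to pass through (or end at) any vertex occupied by a cop. The cops win if eventually a cop steps onto the vertex currently occupied by the robber; the robber wins if he can elude the cops indefinitely. The cop number (against a robber of speed $R$) is the minimum number of cops that have a winning strategy on $G$; the ordinary cop number is the case $R=1$. -}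

module Defs where

open import Data.Empty using (⊥)
open import Data.Fin using (Fin; _<_)
open import Data.List using (List; []; _∷_)
open import Data.Nat using (ℕ; zero; suc; _*_; _^_; _≤_)
open import Data.Product using (Σ; _×_; ∃-syntax)
open import Data.Sum using (_⊎_)
open import Function using (_↔_)
open import Relation.Binary.Definitions using (Symmetric)
open import Relation.Binary.PropositionalEquality using (_≡_; _≢_; refl; ≢-sym)
open import Relation.Nullary using (¬_)

record Graph (V : Set) : Set₁ where
  field
    _~_    : V → V → Set
    ~-sym  : Symmetric _~_
    ~-irr  : ∀ {v} → ¬ (v ~ v)

HasOrder : ∀ {V} → Graph V → ℕ → Set
HasOrder {V} _ m = V ↔ Fin m

complete : (n : ℕ) → Graph (Fin n)
complete n = record { _~_ = _≢_ ; ~-sym = ≢-sym ; ~-irr = λ v≢v → v≢v refl }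

-- The edge {i , j} is represented once, by its endpoints in increasing order;
-- the proofs are irrelevant, so each edge contributes exactly one new vertex.
data SubdivisionVertex {n : ℕ} (H : Graph (Fin n)) : Set where
  branch : Fin n → SubdivisionVertex H
  middle : (i j : Fin n) → .(i < j) → .(Graph._~_ H i j) → SubdivisionVertex H

subdivision : ∀ {n} (H : Graph (Fin n)) → Graph (SubdivisionVertex H)
subdivision {n} H = record
  { _~_ = adj
  ; ~-sym = λ {u} {w} → adj-sym u w
  ; ~-irr = λ {v} → adj-irr v
  }
  where
  adj : SubdivisionVertex H → SubdivisionVertex H → Set
  adj (branch k)         (branch l)         = ⊥
  adj (branch k)         (middle i j _ _)   = k ≡ i ⊎ k ≡ j
  adj (middle i j _ _)   (branch k)         = k ≡ i ⊎ k ≡ j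
  adj (middle _ _ _ _)   (middle _ _ _ _)   = ⊥

  adj-sym : ∀ u w → adj u w → adj w u
  adj-sym (branch _)       (middle _ _ _ _) e = e
  adj-sym (middle _ _ _ _) (branch _)       e = e

  adj-irr : ∀ v → ¬ adj v v
  adj-irr (branch _)       ()
  adj-irr (middle _ _ _ _) ()

module Game {V : Set} (G : Graph V) (R : ℕ) where
  open Graph G

  Placement : ℕ → Set
  Placement k = Fin k → V

  Occupied : ∀ {k} → Placement k → V → Set
  Occupied c v = ∃[ i ] c i ≡ v

  CopsMove : ∀ {k} → Placement k → Placement k → Set
  CopsMove c c′ = ∀ i → c i ≡ c′ i ⊎ c i ~ c′ i

  -- RobberWalk c m u v: a walk from u to v with at most m edges, on which no
  -- vertex after the starting one is occupied by a cop of c.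
  data RobberWalk {k : ℕ} (c : Placement k) : ℕ → V → V → Set where
    stay : ∀ {m v} → RobberWalk c m v v
    step : ∀ {m u w v} → u ~ w → ¬ Occupied c w →
           RobberWalk c m w v → RobberWalk c (suc m) u v

  -- A strategy sees all robber positions so far, most recent first (the cops'
  -- own past moves are determined by these).  `place []` is the initial
  -- placement, chosen before the robber appears.  Moves are also prescribed on
  -- histories that no legal play reaches; this is harmless, since there the
  -- cops can stay put.
  record Strategy (k : ℕ) : Set where
    field
      place : List V → Placement k
      legal : ∀ h r → CopsMove (place h) (place (r ∷ h))

  -- r t is the robber's position after his t-th move, r 0 his initial choice.
  history : (ℕ → V) → ℕ → List V
  history r zero    = []
  history r (suc t) = r t ∷ history r t

  module _ {k : ℕ} (S : Strategy k) where
    open Strategy S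

    -- The cops after their t-th move.
    copsAt : (ℕ → V) → ℕ → Placement k
    copsAt r t = place (history r t)

    LegalPlay : (ℕ → V) → Set
    LegalPlay r = ∀ t → RobberWalk (copsAt r (suc t)) R (r t) (r (suc t))

    -- Some cops' move puts a cop on the vertex where the robber then stands.
    -- Plays are infinite: what happens after a capture is immaterial, and a
    -- captured robber can formally continue by staying put.
    Captured : (ℕ → V) → Set
    Captured r = ∃[ t ] Occupied (copsAt r (suc t)) (r t)

    Winning : Set
    Winning = ∀ r → LegalPlay r → Captured r

  CopsWin : ℕ → Set
  CopsWin k = Σ (Strategy k) Winning

  IsCopNumber : ℕ → Set
  IsCopNumber k = CopsWin k × (∀ j → CopsWin j → k ≤ j)

open Game public using (IsCopNumber)

-- f = Θ(√ g) as n → ∞: for all large n, √(g n) ≤ a · f n and f n ≤ b · √(g n),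
-- with both inequalities squared.  Natural numbers a, b suffice as constants,
-- since any positive real constants can be replaced by 1/a and b.
_=Θ√_ : (ℕ → ℕ) → (ℕ → ℕ) → Set
f =Θ√ g = ∃[ a ] ∃[ b ] ∃[ n₀ ] (∀ n → n₀ ≤ n →
  g n ≤ (a * f n) ^ 2 × f n ^ 2 ≤ b ^ 2 * g n)

{-# OPTIONS --safe #-}

-- Both cop numbers come from explicit strategies lasting at most three rounds.
-- Two cops starting at branch 0 beat a robber of speed 1: one of them chases him
-- off any branch vertex onto a middle vertex, whose far end the other cop then
-- reaches in time.  Against any speed, ⌈ n /2⌉ cops standing on a (near-)perfect
-- matching guard all branch vertices, and the two cops responsible for the ends of
-- the edge on which the robber stands can step onto them and lock him in.
-- Conversely a cop guards at most two branch vertices, so fewer than n / 2 cops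
-- leave an unguarded one y, and a robber of speed 2 on a branch x reaches it
-- through the middle of {x , y}: a cop there would guard y.  A single cop cannot
-- catch a robber of speed 1, as the graph is triangle-free of minimum degree ≥ 2.
module Submission where

open import Data.Empty using (⊥)
open import Data.Fin as Fin using (Fin; zero; suc; combine; remQuot; _≟_)
open import Data.Fin.Properties
  using (<-cmp; <-irrefl; any?; ¬∀⟶∃¬; injective⇒≤; remQuot-combine; suc-injective; +↔⊎)
open import Data.List using (List; []; _∷_)
open import Data.Nat
  using (ℕ; zero; suc; _+_; _*_; _^_; _≤_; _<_; _≤?_; z≤n; s≤s; s<s; z<s; s<s⁻¹; ⌊_/2⌋; ⌈_/2⌉)
open import Data.Nat.Properties
  using (≤-trans; ≤-refl; n≤1+n; <⇒≱; ≰⇒>; m≤n+m; +-identityʳ; +-mono-≤; +-monoˡ-≤;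
         *-identityʳ; *-distribˡ-+; *-monoˡ-≤; *-monoʳ-≤; ^-monoˡ-≤; ⌈n/2⌉-mono; n≡⌈n+n/2⌉;
         ⌈n/2⌉≤n; ⌊n/2⌋+⌈n/2⌉≡n; ⌊n/2⌋≤⌈n/2⌉; module ≤-Reasoning)
open import Data.Nat.Tactic.RingSolver using (solve-∀)
open import Data.Product using (Σ; _×_; _,_; proj₁; proj₂; ∃-syntax)
open import Data.Sum using (_⊎_; inj₁; inj₂; swap)
open import Data.Sum.Function.Propositional using (_⊎-↔_)
open import Data.Unit using (⊤; tt)
open import Function using (_↔_; mk↔ₛ′; id; _∘_)
open import Function.Construct.Composition using (_↔-∘_)
open import Function.Construct.Identity using (↔-id)
open import Function.Construct.Symmetry using (↔-sym)
open import Relation.Binary.Definitions using (tri<; tri≈; tri>)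
open import Relation.Binary.PropositionalEquality
  using (_≡_; _≢_; refl; sym; trans; cong; cong₂; subst; module ≡-Reasoning)
open import Relation.Nullary using (¬_; Dec; yes; no; contradiction; contradiction-irr)
open import Relation.Nullary.Decidable using (_⊎-dec_; map′; decidable-stable)
open import Defs

-- Strategies for both sides on an arbitrary graph.

module Neighbourhood {V : Set} (G : Graph V) where
  open Graph G

  Near : V → V → Set
  Near u v = u ≡ v ⊎ u ~ v

  Guarded : ∀ {k} → (Fin k → V) → V → Set
  Guarded c v = ∃[ i ] Near (c i) v

module Play {V : Set} (G : Graph V) (R : ℕ) where
  open Graph G
  open Neighbourhood G
  open Game G R hiding (IsCopNumber)

  moveTo : ∀ {k} → Placement k → Fin k → V → Placement k
  moveTo c i v j with j ≟ i
  ... | yes _ = v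
  ... | no _  = c j

  moveTo-hit : ∀ {k} (c : Placement k) i v → moveTo c i v i ≡ v
  moveTo-hit c i v with i ≟ i
  ... | yes _   = refl
  ... | no i≢i = contradiction refl i≢i

  moveTo-miss : ∀ {k} (c : Placement k) {i j} v → j ≢ i → moveTo c i v j ≡ c j
  moveTo-miss c {i} {j} v j≢i with j ≟ i
  ... | yes j≡i = contradiction j≡i j≢i
  ... | no _    = refl

  moveTo-legal : ∀ {k} (c : Placement k) {i v} → Near (c i) v → CopsMove c (moveTo c i v)
  moveTo-legal c {i} near j with j ≟ i
  ... | yes refl = near
  ... | no _     = inj₁ refl

  -- A winning strategy of k cops standing at c, on their turn, against a robber
  -- at r.  L says which r the robber could legally have moved to; `illegal` keeps
  -- the tree total in r without a decision procedure for robber walks.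
  data Wins {k : ℕ} (L : V → Set) (c : Placement k) (r : V) : Set where
    illegal : ¬ L r → Wins L c r
    capture : Guarded c r → Wins L c r
    advance : ∀ c′ → CopsMove c c′ → (∀ r′ → Wins (RobberWalk c′ R r) c′ r′) → Wins L c r

  module _ {k : ℕ} where

    record State : Set₁ where
      constructor state
      field
        Legal : V → Set
        cops  : Placement k
        wins  : ∀ r → Wins Legal cops r
    open State

    -- Once the robber is captured or has cheated, the cops stay put for ever: no position counts as
    -- legal, so every later response is again `resting`.
    resting : Placement k → State
    resting c = state (λ _ → ⊥) c (λ _ → illegal id)

    respond : ∀ {L} {c : Placement k} {r} → Wins L c r → State
    respond {c = c}         (illegal _)       = resting c
    respond {c = c} {r = r} (capture (i , _)) = resting (moveTo c i r)
    respond {r = r}         (advance c′ _ f)  = state (RobberWalk c′ R r) c′ f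

    respond-legal : ∀ {L} {c : Placement k} {r} (w : Wins L c r) → CopsMove c (cops (respond w))
    respond-legal         (illegal _)          i = inj₁ refl
    respond-legal {c = c} (capture (_ , near)) = moveTo-legal c near
    respond-legal         (advance _ move _)   = move

    module _ (c₀ : Placement k) (w₀ : ∀ r → Wins (λ _ → ⊤) c₀ r) where

      run : List V → State
      run []      = state (λ _ → ⊤) c₀ w₀
      run (r ∷ h) = respond (wins (run h) r)

      strategy : Strategy k
      strategy = record
        { place = λ h → cops (run h)
        ; legal = λ h r → respond-legal (wins (run h) r)
        }

      -- Induction on the tree `w`. The equation ties the play to the current subtree, which keeps
      -- the recursion structural and turns the legality of the robber's walk into the `L` of the
      -- next subtree.
      captures : ∀ {r} → LegalPlay strategy r → ∀ t {L} {c : Placement k} (w : Wins L c (r t)) →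
                 run (history r (suc t)) ≡ respond w → L (r t) → Captured strategy r
      captures play t (illegal ¬l) _ l = contradiction l ¬l
      captures {r} play t {c = c} (capture (i , _)) eq _ =
        t , i , trans (cong (λ s → cops s i) eq) (moveTo-hit c i (r t))
      captures {r} play t (advance c′ _ f) eq _ =
        captures play (suc t) (f (r (suc t)))
          (cong (λ s → respond (wins s (r (suc t)))) eq)
          (subst (λ s → RobberWalk (cops s) R (r t) (r (suc t))) eq (play t))

      wins⇒copsWin : CopsWin k
      wins⇒copsWin = strategy , λ r play → captures play 0 (w₀ (r 0)) refl tt

  -- The robber ends every move on some `haven w` that no cop guards. No cop can step onto it, and
  -- `flee` then leads to the next one; only vertices in the image of `haven` need an escape.
  module _ {k : ℕ} {W : Set} (haven : W → V)
    (start : (c : Placement k) → ∃[ w ] ¬ Guarded c (haven w))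
    (flee  : (c : Placement k) (u : W) → ¬ Occupied c (haven u) →
             ∃[ w ] RobberWalk c R (haven u) (haven w) × ¬ Guarded c (haven w))
    (S : Strategy k) where
    open Strategy S

    Refuge : List V → Set
    Refuge h = ∃[ w ] ¬ Guarded (place h) (haven w)

    not-caught : ∀ h ((w , _) : Refuge h) → ¬ Occupied (place (haven w ∷ h)) (haven w)
    not-caught h (w , unguarded) (i , caught) =
      unguarded (i , subst (Near (place h i)) caught (legal h (haven w) i))

    escape-route : ∀ h ((w , _) : Refuge h) →
      let c = place (haven w ∷ h) in
      ∃[ w′ ] RobberWalk c R (haven w) (haven w′) × ¬ Guarded c (haven w′)
    escape-route h (w , unguarded) = flee _ w (not-caught h (w , unguarded))

    -- History and refuge grow together: the placement depends on the history, and the next refuge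
    -- on the placement.
    escape : ℕ → Σ (List V) Refuge
    escape zero = [] , start _
    escape (suc t) with escape t
    ... | h , ref with escape-route h ref
    ...   | w′ , _ , unguarded′ = haven (proj₁ ref) ∷ h , w′ , unguarded′

    robber : ℕ → V
    robber t = haven (proj₁ (proj₂ (escape t)))

    robber-history : ∀ t → history robber t ≡ proj₁ (escape t)
    robber-history zero    = refl
    robber-history (suc t) = cong (robber t ∷_) (robber-history t)

    robber-legal : LegalPlay S robber
    robber-legal t rewrite robber-history t = proj₁ (proj₂ (escape-route _ (proj₂ (escape t))))

    robber-free : ¬ Captured S robber
    robber-free (t , caught) rewrite robber-history t = not-caught _ (proj₂ (escape t)) caught

    evasion : ¬ Winning S
    evasion win = robber-free (win robber robber-legal)

-- A near-perfect matching of `Fin n`.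

leftEnd rightEnd : ∀ n → Fin ⌈ n /2⌉ → Fin n
leftEnd (suc zero)    zero    = zero
leftEnd (suc (suc n)) zero    = zero
leftEnd (suc (suc n)) (suc p) = suc (suc (leftEnd n p))
-- For odd n the last vertex is matched with itself.
rightEnd (suc zero)    zero    = zero
rightEnd (suc (suc n)) zero    = suc zero
rightEnd (suc (suc n)) (suc p) = suc (suc (rightEnd n p))

pairOf : ∀ n → Fin n → Fin ⌈ n /2⌉
pairOf (suc zero)    zero          = zero
pairOf (suc (suc n)) zero          = zero
pairOf (suc (suc n)) (suc zero)    = zero
pairOf (suc (suc n)) (suc (suc x)) = suc (pairOf n x)

end-of-pair : ∀ n x → leftEnd n (pairOf n x) ≡ x ⊎ rightEnd n (pairOf n x) ≡ x
end-of-pair (suc zero)    zero          = inj₁ refl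
end-of-pair (suc (suc n)) zero          = inj₁ refl
end-of-pair (suc (suc n)) (suc zero)    = inj₂ refl
end-of-pair (suc (suc n)) (suc (suc x)) with end-of-pair n x
... | inj₁ e = inj₁ (cong (λ (z : Fin n) → suc (suc z)) e)
... | inj₂ e = inj₂ (cong (λ (z : Fin n) → suc (suc z)) e)

-- The subdivided complete graph and the guarding of its branch vertices.

module SubdividedComplete (n : ℕ) where

  G : Graph (SubdivisionVertex (complete n))
  G = subdivision (complete n)

  open Graph G
  open Neighbourhood G

  Vertex : Set
  Vertex = SubdivisionVertex (complete n)

  _≟ᵥ_ : (u v : Vertex) → Dec (u ≡ v)
  branch i ≟ᵥ branch j = map′ (cong branch) (λ { refl → refl }) (i ≟ j)
  branch _ ≟ᵥ middle _ _ _ _ = no λ ()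
  middle _ _ _ _ ≟ᵥ branch _ = no λ ()
  middle i j _ _ ≟ᵥ middle i′ j′ _ _ with i ≟ i′ | j ≟ j′
  ... | yes refl | yes refl = yes refl
  ... | no i≢i′  | _        = no λ { refl → i≢i′ refl }
  ... | yes _    | no j≢j′  = no λ { refl → j≢j′ refl }

  _~?_ : (u v : Vertex) → Dec (u ~ v)
  branch _       ~? branch _       = no λ ()
  branch k       ~? middle i j _ _ = (k ≟ i) ⊎-dec (k ≟ j)
  middle i j _ _ ~? branch k       = (k ≟ i) ⊎-dec (k ≟ j)
  middle _ _ _ _ ~? middle _ _ _ _ = no λ ()

  triangle-free : ∀ u v w → u ~ v → v ~ w → ¬ (u ~ w)
  triangle-free (branch _) (middle _ _ _ _) (branch _) _ _ ()
  triangle-free (middle _ _ _ _) (branch _) (middle _ _ _ _) _ _ ()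

  -- The middle of {x , y}, degenerating to branch x when x ≡ y.
  link : Fin n → Fin n → Vertex
  link x y with <-cmp x y
  ... | tri< x<y x≢y _ = middle x y x<y x≢y
  ... | tri≈ _ _ _     = branch x
  ... | tri> _ x≢y y<x = middle y x y<x (x≢y ∘ sym)

  link-sym : ∀ x y → link x y ≡ link y x
  link-sym x y with <-cmp x y | <-cmp y x
  ... | tri< _ _ _    | tri> _ _ _    = refl
  ... | tri≈ _ refl _ | tri≈ _ _ _    = refl
  ... | tri> _ _ _    | tri< _ _ _    = refl
  ... | tri< _ x≢y _  | tri≈ _ y≡x _  = contradiction (sym y≡x) x≢y
  ... | tri< _ _ y≮x  | tri< y<x _ _  = contradiction y<x y≮x
  ... | tri≈ _ x≡y _  | tri< _ y≢x _  = contradiction (sym x≡y) y≢x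
  ... | tri≈ _ x≡y _  | tri> _ y≢x _  = contradiction (sym x≡y) y≢x
  ... | tri> _ x≢y _  | tri≈ _ y≡x _  = contradiction (sym y≡x) x≢y
  ... | tri> x≮y _ _  | tri> _ _ x<y  = contradiction x<y x≮y

  link-middle : ∀ {x y} .(x<y : x Fin.< y) .(x≢y : x ≢ y) → link x y ≡ middle x y x<y x≢y
  link-middle {x} {y} x<y x≢y with <-cmp x y
  ... | tri< _ _ _   = refl
  ... | tri≈ x≮y _ _ = contradiction-irr x<y x≮y
  ... | tri> x≮y _ _ = contradiction-irr x<y x≮y

  link-adjacent : ∀ {x y} → x ≢ y → branch x ~ link x y
  link-adjacent {x} {y} x≢y with <-cmp x y
  ... | tri< _ _ _   = inj₁ refl
  ... | tri≈ _ x≡y _ = contradiction x≡y x≢y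
  ... | tri> _ _ _   = inj₂ refl

  -- The branch vertices guarded from a vertex; a branch vertex guards only itself and fills both
  -- slots.
  ends : Vertex → Fin 2 → Fin n
  ends (branch x)       _       = x
  ends (middle i _ _ _) zero    = i
  ends (middle _ j _ _) (suc _) = j

  near-sym : ∀ u v → Near u v → Near v u
  near-sym _ _ (inj₁ u≡v) = inj₁ (sym u≡v)
  near-sym u v (inj₂ u~v) = inj₂ (~-sym {u} {v} u~v)

  branch-near-link : ∀ x y → Near (branch x) (link x y)
  branch-near-link x y with <-cmp x y
  ... | tri< _ _ _ = inj₂ (inj₁ refl)
  ... | tri≈ _ _ _ = inj₁ refl
  ... | tri> _ _ _ = inj₂ (inj₂ refl)

  link-nearˡ : ∀ x y → Near (link x y) (branch x)
  link-nearˡ x y = near-sym (branch x) (link x y) (branch-near-link x y)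

  link-nearʳ : ∀ x y → Near (link x y) (branch y)
  link-nearʳ x y = subst (λ v → Near v (branch y)) (link-sym y x) (link-nearˡ y x)

  guarded? : ∀ {k} (c : Fin k → Vertex) v → Dec (Guarded c v)
  guarded? c v = any? λ i → (c i ≟ᵥ v) ⊎-dec (c i ~? v)

  guards⇒end : ∀ u x → Near u (branch x) → ∃[ s ] ends u s ≡ x
  guards⇒end (branch _)       x (inj₁ refl)     = zero , refl
  guards⇒end (middle i j _ _) x (inj₂ (inj₁ e)) = zero , sym e
  guards⇒end (middle i j _ _) x (inj₂ (inj₂ e)) = suc zero , sym e

  -- Sending `x` to a cop guarding it and the slot of `x` among that cop's `ends` is injective,
  -- since `ends` recovers `x`.
  all-guarded⇒≤ : ∀ {k} (c : Fin k → Vertex) → (∀ x → Guarded c (branch x)) → n ≤ k * 2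
  all-guarded⇒≤ {k} c guarded = injective⇒≤ {f = code} λ {x} {y} eq →
    trans (sym (decode-code x)) (trans (cong decode eq) (decode-code y))
    where
    side : ∀ x → ∃[ s ] ends (c (proj₁ (guarded x))) s ≡ x
    side x = guards⇒end _ x (proj₂ (guarded x))

    code : Fin n → Fin (k * 2)
    code x = combine (proj₁ (guarded x)) (proj₁ (side x))

    decode : Fin (k * 2) → Fin n
    decode q = ends (c (proj₁ (remQuot {k} 2 q))) (proj₂ (remQuot {k} 2 q))

    decode-code : ∀ x → decode (code x) ≡ x
    decode-code x = trans
      (cong (λ q → ends (c (proj₁ q)) (proj₂ q)) (remQuot-combine (proj₁ (guarded x)) _))
      (proj₂ (side x))

  unguarded-branch : ∀ {k} → k * 2 < n → (c : Fin k → Vertex) → ∃[ x ] ¬ Guarded c (branch x)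
  unguarded-branch k*2<n c = ¬∀⟶∃¬ n _ (λ x → guarded? c (branch x))
    λ guarded → <⇒≱ k*2<n (all-guarded⇒≤ c guarded)

  -- Speed 1: two cops suffice and fewer do not.

  module Speed1 where
    open Play G 1
    open Game G 1 hiding (IsCopNumber)

    -- A walk of at most one edge stays in the closed neighbourhood of its start, so every other
    -- target is `illegal`.
    near-wins : ∀ {k} {c : Placement k} {u} → (∀ r → Near u r → Wins (RobberWalk c 1 u) c r) →
                ∀ r → Wins (RobberWalk c 1 u) c r
    near-wins {u = u} f r with u ≟ᵥ r | u ~? r
    ... | yes u≡r | _       = f r (inj₁ u≡r)
    ... | no _    | yes u~r = f r (inj₂ u~r)
    ... | no u≢r  | no u≁r  = illegal λ { stay → u≢r refl ; (step u~r _ stay) → u≁r u~r }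

    besiege : ∀ {k L} {c c′ : Placement k} {u} → CopsMove c c′ →
              (∀ r → Near u r → Guarded c′ r) → Wins L c u
    besiege {c′ = c′} move guarded = advance c′ move (near-wins λ r near → capture (guarded r near))

    ⟨_,_⟩ : Vertex → Vertex → Placement 2
    ⟨ a , b ⟩ zero    = a
    ⟨ a , b ⟩ (suc _) = b

    both-move : ∀ {a a′ b b′} → Near a a′ → Near b b′ → CopsMove ⟨ a , b ⟩ ⟨ a′ , b′ ⟩
    both-move near-a near-b zero    = near-a
    both-move near-a near-b (suc _) = near-b

    -- The first cop enters `x`, which also guards the middle vertex; the second guards `y`. The
    -- robber can reach nothing else. Naming the ends `x` and `y` separately allows either order of
    -- `i` and `j`.
    squeeze : ∀ {L a b b′ i j} .{i<j : i Fin.< j} .{i≢j : i ≢ j} x y →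
      let v = middle i j i<j i≢j in
      branch x ~ v → (∀ z → branch z ~ v → z ≡ x ⊎ z ≡ y) →
      Near a (branch x) → Near b b′ → Near b′ (branch y) → Wins L ⟨ a , b ⟩ v
    squeeze {b′ = b′} {i} {j} {i<j} {i≢j} x y x~v ends-v a-x b-b′ b′-y =
      besiege {c′ = c′} (both-move a-x b-b′) guarded
      where
      c′ = ⟨ branch x , b′ ⟩

      guarded : ∀ r → Near (middle i j i<j i≢j) r → Guarded c′ r
      guarded _ (inj₁ refl) = zero , inj₂ x~v
      guarded (branch z) (inj₂ z~v) with ends-v z z~v
      ... | inj₁ refl = zero , inj₁ refl
      ... | inj₂ refl = suc zero , b′-y

    two-cops-win : Fin n → CopsWin 2
    two-cops-win o = wins⇒copsWin ⟨ branch o , branch o ⟩ wins₀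
      where
      wins₀ : ∀ r → Wins (λ _ → ⊤) ⟨ branch o , branch o ⟩ r
      -- From `link o x` the first cop threatens `x`, so staying there loses. If the robber leaves
      -- for a middle vertex, this cop enters `x` while the other moves from `o` to guard the far
      -- end.
      wins₀ (branch x) =
        advance c′ (both-move (branch-near-link o x) (inj₁ refl)) (near-wins chased)
        where
        c′ = ⟨ link o x , branch o ⟩

        chased : ∀ r → Near (branch x) r → Wins (RobberWalk c′ 1 (branch x)) c′ r
        chased _ (inj₁ refl) = capture (zero , link-nearʳ o x)
        chased (middle i j _ _) (inj₂ (inj₁ refl)) =
          squeeze i j (inj₁ refl) (λ _ → id)
            (link-nearʳ o i) (branch-near-link o j) (link-nearʳ o j)
        chased (middle i j _ _) (inj₂ (inj₂ refl)) =
          squeeze j i (inj₂ refl) (λ _ → swap)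
            (link-nearʳ o j) (branch-near-link o i) (link-nearʳ o i)
      -- Each cop heads for one end of the robber's edge. Both ends are then guarded, and if the
      -- robber stays, the cops step onto them.
      wins₀ (middle i j i<j i≢j) =
        advance c′ (both-move (branch-near-link o i) (branch-near-link o j)) (near-wins enclosed)
        where
        c′ = ⟨ link o i , link o j ⟩

        enclosed : ∀ r → Near (middle i j i<j i≢j) r →
                   Wins (RobberWalk c′ 1 (middle i j i<j i≢j)) c′ r
        enclosed _ (inj₁ refl) =
          squeeze i j (inj₁ refl) (λ _ → id) (link-nearʳ o i) (link-nearʳ o j) (inj₁ refl)
        enclosed (branch _) (inj₂ (inj₁ refl)) = capture (zero , link-nearʳ o i)
        enclosed (branch _) (inj₂ (inj₂ refl)) = capture (suc zero , link-nearʳ o j)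

    other-neighbour : 3 ≤ n → ∀ v u → v ~ u → ∃[ w ] u ~ w × w ≢ v
    other-neighbour 3≤n (branch k) (middle i j i<j _) _ with k ≟ i
    ... | yes refl = branch j , inj₂ refl , λ { refl → contradiction-irr i<j (<-irrefl refl) }
    ... | no k≢i   = branch i , inj₁ refl , λ { refl → k≢i refl }
    -- A cop at `v` guards at most two branch vertices, so it misses some `y`. Hence `y` is not `x`,
    -- and `link x y`, being near `y`, is not `v`.
    other-neighbour 3≤n v@(middle _ _ _ _) (branch x) v~x with unguarded-branch {1} 3≤n (λ _ → v)
    ... | y , unguarded =
      link x y ,
      link-adjacent (λ { refl → unguarded (zero , inj₂ v~x) }) ,
      λ eq → unguarded (zero , subst (λ u → Near u (branch y)) eq (link-nearʳ x y))

    Fin-irrelevant : ∀ {k} → k < 2 → (i j : Fin k) → i ≡ j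
    Fin-irrelevant {1} _ zero zero = refl
    Fin-irrelevant {suc (suc _)} (s≤s (s≤s ()))

    copsWin⇒≥2 : 3 ≤ n → ∀ k → CopsWin k → 2 ≤ k
    copsWin⇒≥2 3≤n k (S , win) = decidable-stable (2 ≤? k) λ 2≰k →
      let k<2 = ≰⇒> 2≰k in
      evasion id (start k<2) (flee k<2) S win
      where
      start : k < 2 → (c : Placement k) → ∃[ v ] ¬ Guarded c v
      start (s≤s k≤1) c with unguarded-branch (≤-trans (s≤s (*-monoˡ-≤ 2 k≤1)) 3≤n) c
      ... | x , unguarded = branch x , unguarded

      flee : k < 2 → (c : Placement k) (u : Vertex) → ¬ Occupied c u →
             ∃[ w ] RobberWalk c 1 u w × ¬ Guarded c w
      flee k<2 c u free with guarded? c u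
      ... | no unguarded         = u , stay , unguarded
      ... | yes (i , inj₁ ci≡u) = contradiction (i , ci≡u) free
      -- The only cop is adjacent to `u`; in a triangle-free graph it guards no other neighbour of
      -- `u`.
      ... | yes (i , inj₂ ci~u) with other-neighbour 3≤n (c i) u ci~u
      ...   | w , u~w , w≢ci = w , step u~w (λ (j , e) → unoccupied j e) stay , λ where
                (j , inj₁ e)    → unoccupied j e
                (j , inj₂ cj~w) → triangle-free (c i) u w ci~u u~w
                  (subst (λ m → c m ~ w) (Fin-irrelevant k<2 j i) cj~w)
        where
        unoccupied : ∀ j → c j ≢ w
        unoccupied j cj≡w = w≢ci (trans (sym cj≡w) (cong c (Fin-irrelevant k<2 j i)))

  -- Speed 2: the lower bound.

  module Speed2 where
    open Play G 2
    open Game G 2 hiding (IsCopNumber)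

    copsWin⇒≥⌈n/2⌉ : ∀ k → CopsWin k → ⌈ n /2⌉ ≤ k
    copsWin⇒≥⌈n/2⌉ k (S , win) = begin
      ⌈ n /2⌉      ≤⟨ ⌈n/2⌉-mono n≤k+k ⟩
      ⌈ k + k /2⌉  ≡⟨ n≡⌈n+n/2⌉ k ⟨
      k            ∎
      where
      open ≤-Reasoning

      flee : k * 2 < n → (c : Placement k) (x : Fin n) → ¬ Occupied c (branch x) →
             ∃[ y ] RobberWalk c 2 (branch x) (branch y) × ¬ Guarded c (branch y)
      flee k*2<n c x _ with unguarded-branch k*2<n c
      ... | y , unguarded with x ≟ y
      ...   | yes refl = y , stay , unguarded
      ...   | no x≢y   = y , step (link-adjacent x≢y) link-free (step link~y y-free stay) , unguarded
        where
        link~y : link x y ~ branch y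
        link~y = ~-sym {branch y} {link x y}
          (subst (branch y ~_) (link-sym y x) (link-adjacent (x≢y ∘ sym)))

        link-free : ¬ Occupied c (link x y)
        link-free (i , e) = unguarded (i , inj₂ (subst (_~ branch y) (sym e) link~y))

        y-free : ¬ Occupied c (branch y)
        y-free (i , e) = unguarded (i , inj₁ e)

      n≤k+k : n ≤ k + k
      n≤k+k = decidable-stable (n ≤? k + k) λ n≰k+k →
        let k*2<n = subst (_< n) (k+k≡k*2 k) (≰⇒> n≰k+k) in
        evasion branch (unguarded-branch k*2<n) (flee k*2<n) S win
        where
        k+k≡k*2 : ∀ m → m + m ≡ m * 2
        k+k≡k*2 = solve-∀

  -- The matching strategy, at every speed.

  module AnySpeed (R : ℕ) where
    open Play G R
    open Game G R hiding (IsCopNumber)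

    pair : Fin n → Fin ⌈ n /2⌉
    pair = pairOf n

    -- One cop on the middle of each matching edge; for odd `n` the last cop stands on the unmatched
    -- branch vertex, where `link` degenerates.
    home : Placement ⌈ n /2⌉
    home p = link (leftEnd n p) (rightEnd n p)

    home-guards : ∀ x → Near (home (pair x)) (branch x)
    home-guards x with end-of-pair n x
    ... | inj₁ e = subst (Near (home (pair x)) ∘ branch) e (link-nearˡ _ _)
    ... | inj₂ e = subst (Near (home (pair x)) ∘ branch) e (link-nearʳ _ _)

    -- Distinct members of one pair are its two opposite ends. This settles a robber who starts on a
    -- matching edge: a cop is already there.
    home-of-pair : ∀ {x y} → x ≢ y → pair x ≡ pair y → home (pair x) ≡ link x y
    home-of-pair {x} {y} x≢y eq with end-of-pair n x | end-of-pair n y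
    ... | inj₁ ex | inj₂ ey = cong₂ link ex (trans (cong (rightEnd n) eq) ey)
    ... | inj₂ ex | inj₁ ey =
      trans (cong₂ link (trans (cong (leftEnd n) eq) ey) ex) (link-sym y x)
    ... | inj₁ ex | inj₁ ey = contradiction (trans (sym ex) (trans (cong (leftEnd n) eq) ey)) x≢y
    ... | inj₂ ex | inj₂ ey = contradiction (trans (sym ex) (trans (cong (rightEnd n) eq) ey)) x≢y

    -- Any walk leaving a middle vertex first enters one of its two ends, and both are occupied, so
    -- no speed helps.
    stuck : ∀ {k m} {c : Placement k} {x y r} .{x<y : x Fin.< y} .{x≢y : x ≢ y} →
            Occupied c (branch x) → Occupied c (branch y) →
            RobberWalk c m (middle x y x<y x≢y) r → middle x y x<y x≢y ≡ r
    stuck _   _   stay = refl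
    stuck atx aty (step {w = branch _} (inj₁ refl) free _) = contradiction atx free
    stuck atx aty (step {w = branch _} (inj₂ refl) free _) = contradiction aty free

    ⌈n/2⌉-cops-win : CopsWin ⌈ n /2⌉
    ⌈n/2⌉-cops-win = wins⇒copsWin home wins₀
      where
      wins₀ : ∀ r → Wins (λ _ → ⊤) home r
      wins₀ (branch x) = capture (pair x , home-guards x)
      wins₀ (middle x y x<y x≢y) with pair x ≟ pair y
      ... | yes eq = capture (pair x , inj₁
              (trans (home-of-pair (λ x≡y → contradiction-irr x<y (<-irrefl x≡y)) eq)
                (link-middle x<y x≢y)))
      ... | no px≢py = advance c′ move locked-in
        where
        v : Vertex
        v = middle x y x<y x≢y

        -- The pairs differ, so two different cops move, and the second `moveTo` leaves the first
        -- cop on `branch x`.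
        c c′ : Placement ⌈ n /2⌉
        c  = moveTo home (pair x) (branch x)
        c′ = moveTo c (pair y) (branch y)

        move : CopsMove home c′
        move p with p ≟ pair y
        ... | yes refl = home-guards y
        ... | no _     = moveTo-legal home (home-guards x) p

        at-x : c′ (pair x) ≡ branch x
        at-x = trans (moveTo-miss c (branch y) px≢py) (moveTo-hit home (pair x) (branch x))

        at-y : c′ (pair y) ≡ branch y
        at-y = moveTo-hit c (pair y) (branch y)

        locked-in : ∀ r → Wins (RobberWalk c′ R v) c′ r
        locked-in r with v ≟ᵥ r
        ... | yes refl = capture (pair x , inj₂ (subst (_~ v) (sym at-x) (inj₁ refl)))
        ... | no v≢r   = illegal (v≢r ∘ stuck (pair x , at-x) (pair y , at-y))

-- The number of vertices, a triangular number, and its growth.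

order : ℕ → ℕ
order zero    = 0
order (suc n) = suc n + order n

-- A vertex of the subdivision of K_{1+n} is either the middle of {zero , j}, read
-- as branch zero when j = zero, or a vertex of the subdivision of K_n.
peel : ∀ n → SubdivisionVertex (complete (suc n)) ↔ (Fin (suc n) ⊎ SubdivisionVertex (complete n))
peel n = mk↔ₛ′ to from to-from from-to
  where
  to : SubdivisionVertex (complete (suc n)) → Fin (suc n) ⊎ SubdivisionVertex (complete n)
  to (branch zero)                   = inj₁ zero
  to (branch (suc i))                = inj₂ (branch i)
  to (middle zero j _ _)             = inj₁ j
  to (middle (suc i) (suc j) i<j i≢j) = inj₂ (middle i j (s<s⁻¹ i<j) (i≢j ∘ cong suc))

  from : Fin (suc n) ⊎ SubdivisionVertex (complete n) → SubdivisionVertex (complete (suc n))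
  from (inj₁ zero)                   = branch zero
  from (inj₁ (suc j))                = middle zero (suc j) z<s (λ ())
  from (inj₂ (branch i))             = branch (suc i)
  from (inj₂ (middle i j i<j i≢j))   = middle (suc i) (suc j) (s<s i<j) (i≢j ∘ suc-injective)

  to-from : ∀ x → to (from x) ≡ x
  to-from (inj₁ zero)             = refl
  to-from (inj₁ (suc _))          = refl
  to-from (inj₂ (branch _))       = refl
  to-from (inj₂ (middle _ _ _ _)) = refl

  from-to : ∀ v → from (to v) ≡ v
  from-to (branch zero)                 = refl
  from-to (branch (suc _))              = refl
  from-to (middle zero (suc _) _ _)     = refl
  from-to (middle (suc _) (suc _) _ _)  = refl

hasOrder : ∀ n → HasOrder (subdivision (complete n)) (order n)
hasOrder zero    = mk↔ₛ′ (λ { (branch ()) }) (λ ()) (λ ()) (λ { (branch ()) })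
hasOrder (suc n) = ↔-sym +↔⊎ ↔-∘ ((↔-id _ ⊎-↔ hasOrder n) ↔-∘ peel n)

order≤n² : ∀ n → order n ≤ n * n
order≤n² zero    = z≤n
order≤n² (suc n) = s≤s (+-mono-≤ (≤-refl {n}) (≤-trans (order≤n² n) (*-monoʳ-≤ n (n≤1+n n))))

-- The closed form of the triangular numbers, doubled to avoid division.
order-double : ∀ n → 2 * order n ≡ n + n * n
order-double zero    = refl
order-double (suc n) = begin
  2 * (suc n + order n)      ≡⟨ *-distribˡ-+ 2 (suc n) (order n) ⟩
  2 * suc n + 2 * order n    ≡⟨ cong (2 * suc n +_) (order-double n) ⟩
  2 * suc n + (n + n * n)    ≡⟨ lemma n ⟩
  suc n + suc n * suc n      ∎
  where
  open ≡-Reasoning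
  lemma : ∀ n → 2 * suc n + (n + n * n) ≡ suc n + suc n * suc n
  lemma = solve-∀

n≤2*⌈n/2⌉ : ∀ n → n ≤ 2 * ⌈ n /2⌉
n≤2*⌈n/2⌉ n = begin
  n                      ≡⟨ ⌊n/2⌋+⌈n/2⌉≡n n ⟨
  ⌊ n /2⌋ + ⌈ n /2⌉      ≤⟨ +-monoˡ-≤ ⌈ n /2⌉ (⌊n/2⌋≤⌈n/2⌉ n) ⟩
  ⌈ n /2⌉ + ⌈ n /2⌉      ≡⟨ cong (⌈ n /2⌉ +_) (+-identityʳ ⌈ n /2⌉) ⟨
  2 * ⌈ n /2⌉            ∎
  where open ≤-Reasoning

⌈n/2⌉=Θ√order : ⌈_/2⌉ =Θ√ order
-- The first 2 comes from `n ≤ 2 * ⌈ n /2⌉` and `order n ≤ n * n`; the second from `⌈ n /2⌉ ≤ n` and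
-- `n * n ≤ 2 * order n`, with a factor of 2 to spare.
⌈n/2⌉=Θ√order = 2 , 2 , 0 , λ n _ → upper n , lower n
  where
  open ≤-Reasoning
  n^2≡n*n : ∀ n → n ^ 2 ≡ n * n
  n^2≡n*n n = cong (n *_) (*-identityʳ n)

  upper : ∀ n → order n ≤ (2 * ⌈ n /2⌉) ^ 2
  upper n = begin
    order n            ≤⟨ order≤n² n ⟩
    n * n              ≡⟨ n^2≡n*n n ⟨
    n ^ 2              ≤⟨ ^-monoˡ-≤ 2 (n≤2*⌈n/2⌉ n) ⟩
    (2 * ⌈ n /2⌉) ^ 2  ∎

  lower : ∀ n → ⌈ n /2⌉ ^ 2 ≤ 2 ^ 2 * order n
  lower n = begin
    ⌈ n /2⌉ ^ 2    ≤⟨ ^-monoˡ-≤ 2 (⌈n/2⌉≤n n) ⟩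
    n ^ 2          ≡⟨ n^2≡n*n n ⟩
    n * n          ≤⟨ m≤n+m (n * n) n ⟩
    n + n * n      ≡⟨ order-double n ⟨
    2 * order n    ≤⟨ *-monoˡ-≤ (order n) (s≤s (s≤s (z≤n {2}))) ⟩
    2 ^ 2 * order n ∎

proposition5p1 : (∀ n → 3 ≤ n →
    IsCopNumber (subdivision (complete n)) 1 2 ×
    IsCopNumber (subdivision (complete n)) 2 ⌈ n /2⌉)
    × (∃[ v ] (∀ n → HasOrder (subdivision (complete n)) (v n)) × (⌈_/2⌉ =Θ√ v))
proposition5p1 = cop-numbers , order , hasOrder , ⌈n/2⌉=Θ√order
  where
  cop-numbers : ∀ n → 3 ≤ n →
    IsCopNumber (subdivision (complete n)) 1 2 ×
    IsCopNumber (subdivision (complete n)) 2 ⌈ n /2⌉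
  -- The pattern `suc _` provides `zero` as the starting branch vertex of the two cops.
  cop-numbers n@(suc _) 3≤n =
    (Speed1.two-cops-win zero , Speed1.copsWin⇒≥2 3≤n) ,
    (AnySpeed.⌈n/2⌉-cops-win 2 , Speed2.copsWin⇒≥⌈n/2⌉)
    where open SubdividedComplete n
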